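{- For every pair of integers $r$ and $k$ with $r\ge 2$, $k$ positive, $r+k\equiv 0\pmod 2$ and $k\le r$, there exist infinitely many triples $(G,P,d)$ such that (1) $G$ is a graph with $\chi(G)\le r$, (2) $P\subset V(G)$ and $|\mathcal{D}_G(P,2)|=2(r+k-1)$, (3) $d\colon P\to[r+k]$ is a precoloring of $P$ in $G$, and (4) $d$ cannot be extended to a $\frac{3r+k}{2}$-coloring of $G$.
   Context: For a graph $G$, $P\subset V(G)$ and a positive integer $k$, $\mathcal{D}_G(P,k)=\{\{x,y\}\subset P: x\ne y,\ d_G(x,y)\le k\}$, where $d_G$ is the distance in $G$. $[m]=\{1,\dots,m\}$. A precoloring of $P$ in $G$ is a proper coloring of $G[P]$; an $m$-coloring of $G$ is a proper coloring using at most $m$ colors; $d$ is extended by a coloring $f$ of $G$ if $f(v)=d(v)$ for all $v\in P$. -}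

module Defs where

open import Data.Bool.Base using (Bool; T)
open import Data.Fin.Base using (Fin)
open import Data.List.Base using (List; length)
open import Data.List.Membership.Propositional using (_∈_)
open import Data.Nat.Base using (ℕ; zero; suc; _≤_)
open import Data.Product.Base using (Σ; ∃; _×_; _,_; proj₁; proj₂)
open import Data.Sum.Base using (_⊎_; inj₁; inj₂)
open import Function.Base using (_on_)
open import Function.Bundles using (_↔_; _⇔_; Inverse; Bijection)
open import Level using (Level; 0ℓ)
open import Relation.Binary.Bundles using (Setoid)
open import Relation.Binary.Core using (Rel)
open import Relation.Binary.Definitions using (Decidable; Irreflexive; Symmetric)
open import Relation.Binary.PropositionalEquality using (_≡_; _≢_; refl; sym; trans; setoid)
import Relation.Binary.Construct.On as On
open import Relation.Nullary.Negation using (¬_)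

private
  variable
    a ℓ : Level

HasCardinality : Setoid a ℓ → ℕ → Set _
HasCardinality S n = Bijection (setoid (Fin n)) S

record Graph : Set₁ where
  field
    V        : Set
    order    : ℕ
    finite   : V ↔ Fin order
    _~_      : Rel V 0ℓ
    ~-dec    : Decidable _~_
    ~-sym    : Symmetric _~_
    ~-irrefl : Irreflexive _≡_ _~_

open Graph public using (V)

Adj : (G : Graph) → Rel (V G) 0ℓ
Adj = Graph._~_

VertexSet : Graph → Set
VertexSet G = V G → Bool

Elem : (G : Graph) → VertexSet G → Set
Elem G P = Σ (V G) λ v → T (P v)

-- Distance: the length of a shortest walk, undefined (infinite) when x and y
-- lie in different components.

data Walk (G : Graph) : V G → V G → ℕ → Set where
  []  : ∀ {x} → Walk G x x zero
  _∷_ : ∀ {x y z n} → Adj G x y → Walk G y z n → Walk G x z (suc n)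

IsDistance : (G : Graph) → V G → V G → ℕ → Set
IsDistance G x y n = Walk G x y n × (∀ m → Walk G x y m → n ≤ m)

DistanceAtMost : (G : Graph) → V G → V G → ℕ → Set
DistanceAtMost G x y k = ∃ λ n → IsDistance G x y n × n ≤ k

-- Unordered pairs {x , y} are ordered pairs up to swapping.

unorderedPairs : Set → Setoid 0ℓ 0ℓ
unorderedPairs A = record
  { Carrier       = A × A
  ; _≈_           = λ (x , y) (x′ , y′) → (x ≡ x′ × y ≡ y′) ⊎ (x ≡ y′ × y ≡ x′)
  ; isEquivalence = record
    { refl  = inj₁ (refl , refl)
    ; sym   = λ where
        (inj₁ (p , q)) → inj₁ (sym p , sym q)
        (inj₂ (p , q)) → inj₂ (sym q , sym p)
    ; trans = λ where
        (inj₁ (p , q)) (inj₁ (p′ , q′)) → inj₁ (trans p p′ , trans q q′)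
        (inj₁ (p , q)) (inj₂ (p′ , q′)) → inj₂ (trans p p′ , trans q q′)
        (inj₂ (p , q)) (inj₁ (p′ , q′)) → inj₂ (trans p q′ , trans q p′)
        (inj₂ (p , q)) (inj₂ (p′ , q′)) → inj₁ (trans p q′ , trans q p′)
    }
  }

-- 𝒟 G P k = { {x , y} ⊂ P : x ≠ y , d_G(x , y) ≤ k }; elements are compared
-- only through their underlying unordered pair.
𝒟 : (G : Graph) → VertexSet G → ℕ → Setoid 0ℓ 0ℓ
𝒟 G P k = On.setoid (unorderedPairs (V G)) (proj₁ {B = InD})
  where
  InD : V G × V G → Set
  InD (x , y) = T (P x) × T (P y) × x ≢ y × DistanceAtMost G x y k

-- Colors are natural numbers; [ m ] is {1 , … , m}.

_∈[_] : ℕ → ℕ → Set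
c ∈[ m ] = 1 ≤ c × c ≤ m

IsProper : {A : Set} → Rel A 0ℓ → (A → ℕ) → Set
IsProper _~_ f = ∀ x y → x ~ y → f x ≢ f y

UsesAtMost : {A : Set} → ℕ → (A → ℕ) → Set
UsesAtMost m f = ∃ λ (cs : List ℕ) → length cs ≤ m × (∀ v → f v ∈ cs)

IsColoring : (G : Graph) → ℕ → (V G → ℕ) → Set
IsColoring G m f = IsProper (Adj G) f × UsesAtMost m f

Colorable : Graph → ℕ → Set
Colorable G m = ∃ λ f → IsColoring G m f

IsChromaticNumber : Graph → ℕ → Set
IsChromaticNumber G c = Colorable G c × (∀ m → Colorable G m → c ≤ m)

ChromaticNumberAtMost : Graph → ℕ → Set
ChromaticNumberAtMost G r = ∃ λ c → IsChromaticNumber G c × c ≤ r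

IsPrecoloring : (G : Graph) (P : VertexSet G) → (Elem G P → ℕ) → Set
IsPrecoloring G P d = IsProper (Adj G on proj₁) d

Extends : (G : Graph) (P : VertexSet G) → (V G → ℕ) → (Elem G P → ℕ) → Set
Extends G P f d = ∀ v (v∈P : T (P v)) → f v ≡ d (v , v∈P)

ExtendableTo : (G : Graph) (P : VertexSet G) → (Elem G P → ℕ) → ℕ → Set
ExtendableTo G P d m = ∃ λ f → IsColoring G m f × Extends G P f d

record Triple : Set₁ where
  field
    G : Graph
    P : VertexSet G
    d : Elem G P → ℕ

record _≅_ (s t : Triple) : Set where
  private
    module S = Triple s
    module T′ = Triple t
  field
    bij : V S.G ↔ V T′.G
  φ : V S.G → V T′.G
  φ = Inverse.to bij
  field
    adj : ∀ x y → Adj S.G x y ⇔ Adj T′.G (φ x) (φ y)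
    set : ∀ x → S.P x ≡ T′.P (φ x)
    col : ∀ x (p : T (S.P x)) (q : T (T′.P (φ x))) → S.d (x , p) ≡ T′.d (φ x , q)

-- Counted up to isomorphism, so that renaming vertices does not yield new
-- triples.
InfinitelyMany : (Triple → Set) → Set₁
InfinitelyMany Φ = Σ (ℕ → Triple) λ t →
  (∀ i → Φ (t i)) × (∀ i j → i ≢ j → ¬ (t i ≅ t j))

{-# OPTIONS --safe #-}

-- Put n = r + k. Take a complete r-partite graph whose parts are indexed by the
-- colors 2, …, n, and join every vertex to a precolored vertex of color 1 and to
-- one whose color is its own index. The precolored vertices are shared by all
-- the parts other than the first one, so only two families of them are needed,
-- and the only close pairs are the n − 1 pairs {1 , c} inside each family.
--
-- No part can use color 1, and a part using a single color must use one outside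
-- [n]. Give a color weight 1 if it lies in [n] and weight 2 otherwise: each of
-- the r parts has weight at least 2, and color 1 contributes to none of them, so
-- 2r + 1 ≤ n + 2(m − n) when m colors are used, that is 3r + k < 2m.
-- Isolated vertices produce infinitely many examples.
module Submission where

open import Defs
open import Data.Bool using (Bool; true; false; T)
open import Data.Empty using (⊥)
open import Data.Fin using (Fin; zero; suc; toℕ; remQuot; combine)
open import Data.Fin.Properties using (_≟_; toℕ-injective; toℕ<n; injective⇒≤; +↔⊎; *↔×; any?; remQuot-combine; combine-injective)
open import Data.Fin.Permutation using (↔⇒≡)
open import Data.List using (length; upTo)
open import Data.List.Membership.Propositional using (_∈_)
open import Data.List.Membership.Propositional.Properties using (∈-upTo⁺)
open import Data.List.Membership.Setoid.Properties using (index-injective)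
open import Data.List.Properties using (length-upTo)
open import Data.List.Relation.Unary.Any using (index)
open import Data.Nat using (ℕ; zero; suc; _+_; _*_; _∸_; _≤_; _/_; _%_; z≤n; s≤s)
open import Data.Nat.DivMod using (m/n*n≤m)
open import Data.Nat.Properties using (≤-refl; ≤-reflexive; ≤-trans; <-irrefl; *-monoˡ-≤; suc-injective; +-cancelˡ-≡; module ≤-Reasoning)
import Data.Nat.Properties as ℕ
open import Data.Nat.Tactic.RingSolver using (solve-∀)
open import Data.Product using (Σ; ∃; _×_; _,_; proj₁; proj₂)
open import Data.Sum using (_⊎_; inj₁; inj₂)
open import Data.Sum.Function.Propositional using (_⊎-↔_)
open import Data.Unit using (tt)
open import Function using (_∘_; _↔_; Inverse; Injection; Injective; case_of_)
open import Function.Construct.Composition using (_↔-∘_)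
open import Function.Construct.Identity using (↔-id)
open import Function.Construct.Symmetry using (↔-sym)
open import Function.Properties.Inverse using (↔⇒↣)
open import Relation.Binary.Bundles using (Setoid)
open import Relation.Binary.PropositionalEquality using (_≡_; _≢_; refl; sym; trans; cong; subst; setoid; ≢-sym)
open import Relation.Nullary using (¬_; Dec; yes; no; contradiction; ¬?; _×-dec_; _⊎-dec_)

-- Lower bounds on the number of colors.

injective-on-colors⇒≤ : {A : Set} {m t : ℕ} {f : A → ℕ} → UsesAtMost m f →
  (g : Fin t → A) → Injective _≡_ _≡_ (f ∘ g) → t ≤ m
injective-on-colors⇒≤ (cs , len , f∈cs) g inj =
  ≤-trans (injective⇒≤ λ {x} {y} eq → inj (index-injective (setoid ℕ) (f∈cs (g x)) (f∈cs (g y)) eq)) len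

-- A color has room for `w` tags, so `m` colors offer `m * w` slots: the position of the color in
-- the list, paired with the tag, encodes `B` injectively.
injective-on-weighted-colors⇒≤ : {A B : Set} {m t w : ℕ} {f : A → ℕ} → UsesAtMost m f →
  Fin t ↔ B → (g : B → A × Fin w) →
  (∀ x y → f (proj₁ (g x)) ≡ f (proj₁ (g y)) → proj₂ (g x) ≡ proj₂ (g y) → x ≡ y) →
  t ≤ m * w
injective-on-weighted-colors⇒≤ {B = B} {w = w} {f = f} (cs , len , f∈cs) e g inj =
  ≤-trans (injective⇒≤ {f = code ∘ Inverse.to e} λ eq → Injection.injective (↔⇒↣ e) (code-injective eq))
          (*-monoˡ-≤ w len)
  where
  color∈ : ∀ x → f (proj₁ (g x)) ∈ cs
  color∈ x = f∈cs (proj₁ (g x))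

  code : B → Fin (length cs * w)
  code x = combine (index (color∈ x)) (proj₂ (g x))

  code-injective : Injective _≡_ _≡_ code
  code-injective {x} {y} eq =
    let i≡ , b≡ = combine-injective (index (color∈ x)) _ (index (color∈ y)) _ eq
    in inj x y (index-injective (setoid ℕ) (color∈ x) (color∈ y) i≡) b≡

-- Here r = 2 + r′, and the index zero of a precolored vertex is the color 1.
module Construction (r′ k : ℕ) where

  -- The graph and its precoloring.

  r n′ n : ℕ
  r  = 2 + r′
  n′ = suc r′ + k
  n  = suc n′

  Vertex : ℕ → Set
  Vertex N = (Fin r × Fin n′) ⊎ (Fin 2 × Fin n) ⊎ Fin N

  pattern core j i = inj₁ (j , i)
  pattern pre s c  = inj₂ (inj₁ (s , c))
  pattern isolated x = inj₂ (inj₂ x)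

  -- A single family would not do: its vertex of color 1, joined to every part, would complete a
  -- clique on `r + 1` vertices. With two, each family misses some part.
  family : Fin r → Fin 2
  family zero    = zero
  family (suc _) = suc zero

  Attached : Fin r → Fin n′ → Fin 2 → Fin n → Set
  Attached j i s c = family j ≡ s × (c ≡ zero ⊎ c ≡ suc i)

  attached? : ∀ j i s c → Dec (Attached j i s c)
  attached? j i s c = (family j ≟ s) ×-dec ((c ≟ zero) ⊎-dec (c ≟ suc i))

  infix 4 _~_

  _~_ : {N : ℕ} → Vertex N → Vertex N → Set
  core j _ ~ core j′ _ = j ≢ j′
  core j i ~ pre s c   = Attached j i s c
  pre s c  ~ core j i  = Attached j i s c
  _        ~ _         = ⊥

  ~-dec : {N : ℕ} (x y : Vertex N) → Dec (x ~ y)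
  ~-dec (core j _)   (core j′ _)  = ¬? (j ≟ j′)
  ~-dec (core j i)   (pre s c)    = attached? j i s c
  ~-dec (core _ _)   (isolated _) = no λ ()
  ~-dec (pre s c)    (core j i)   = attached? j i s c
  ~-dec (pre _ _)    (pre _ _)    = no λ ()
  ~-dec (pre _ _)    (isolated _) = no λ ()
  ~-dec (isolated _) _            = no λ ()

  ~-sym : {N : ℕ} (x y : Vertex N) → x ~ y → y ~ x
  ~-sym (core _ _) (core _ _) j≢j′ = ≢-sym j≢j′
  ~-sym (core _ _) (pre _ _)  a    = a
  ~-sym (pre _ _)  (core _ _) a    = a

  ~-irrefl : {N : ℕ} (x : Vertex N) → ¬ (x ~ x)
  ~-irrefl (core _ _) j≢j = j≢j refl
  ~-irrefl (pre _ _)  ()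
  ~-irrefl (isolated _) ()

  graph : ℕ → Graph
  graph N = record
    { V        = Vertex N
    ; order    = r * n′ + (2 * n + N)
    ; finite   = ↔-sym ((*↔× ⊎-↔ ((*↔× ⊎-↔ ↔-id _) ↔-∘ +↔⊎)) ↔-∘ +↔⊎)
    ; _~_      = _~_
    ; ~-dec    = ~-dec
    ; ~-sym    = λ {x} {y} → ~-sym x y
    ; ~-irrefl = λ { {x} refl → ~-irrefl x }
    }

  precolored : {N : ℕ} → Vertex N → Bool
  precolored (pre _ _) = true
  precolored _         = false

  precoloring : {N : ℕ} → Elem (graph N) precolored → ℕ
  precoloring (pre _ c , _) = suc (toℕ c)

  triple : ℕ → Triple
  triple N = record { G = graph N ; P = precolored ; d = precoloring }

  -- Chromatic number.

  module _ {N : ℕ} where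

    -- A precolored vertex joins the class of a part that its family is not attached to.
    class : Vertex N → Fin r
    class (core j _)      = j
    class (pre zero _)    = suc zero
    class (pre (suc _) _) = zero
    class (isolated _)    = zero

    family≢class : ∀ j i s c → Attached j i s c → j ≢ class (pre s c)
    family≢class zero    i _ c (refl , _) ()
    family≢class (suc j) i _ c (refl , _) ()

    class-proper : (x y : Vertex N) → x ~ y → class x ≢ class y
    class-proper (core _ _) (core _ _) j≢j′ = j≢j′
    class-proper (core j i) (pre s c)  a    = family≢class j i s c a
    class-proper (pre s c)  (core j i) a    = ≢-sym (family≢class j i s c a)

    r-colorable : Colorable (graph N) r
    r-colorable = toℕ ∘ class , (λ x y x~y eq → class-proper x y x~y (toℕ-injective eq)) ,
      upTo r , ≤-reflexive (length-upTo r) , λ v → ∈-upTo⁺ (toℕ<n (class v))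

    chromaticNumber : IsChromaticNumber (graph N) r
    chromaticNumber = r-colorable , λ m (f , proper , uses) →
      -- One vertex from each part gives a clique of size `r`.
      injective-on-colors⇒≤ uses (λ j → core j zero) λ {j} {j′} eq → case j ≟ j′ of λ where
        (yes j≡j′) → j≡j′
        (no j≢j′)  → contradiction eq (proper (core j zero) (core j′ zero) j≢j′)

    precoloring-range : (v : Elem (graph N) precolored) → precoloring v ∈[ n ]
    precoloring-range (pre _ c , _) = s≤s z≤n , toℕ<n c

    precoloring-proper : IsPrecoloring (graph N) precolored precoloring
    precoloring-proper (pre _ _ , _) (pre _ _ , _) ()

    -- Precolored pairs at distance at most two.

    CloseDistinct : Vertex N × Vertex N → Set
    CloseDistinct (x , y) =
      T (precolored x) × T (precolored y) × x ≢ y × DistanceAtMost (graph N) x y 2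

    member : Fin 2 → Fin r
    member zero    = zero
    member (suc _) = suc zero

    family-member : ∀ s → family (member s) ≡ s
    family-member zero       = refl
    family-member (suc zero) = refl

    closePair : Fin 2 × Fin n′ → Σ (Vertex N × Vertex N) CloseDistinct
    closePair (s , i) = (pre s zero , pre s (suc i)) , tt , tt , (λ ()) , 2 , (walk , shortest) , ≤-refl
      where
      walk : Walk (graph N) (pre s zero) (pre s (suc i)) 2
      walk = _∷_ {y = core (member s) i} (family-member s , inj₁ refl)
               ((family-member s , inj₂ refl) ∷ [])

      shortest : ∀ m → Walk (graph N) (pre s zero) (pre s (suc i)) m → 2 ≤ m
      shortest _ (() ∷ [])
      shortest _ (_ ∷ (_ ∷ _)) = s≤s (s≤s z≤n)

    open Setoid (𝒟 (graph N) precolored 2) using (_≈_)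

    closePair-injective : ∀ p q → closePair p ≈ closePair q → p ≡ q
    closePair-injective _ _ (inj₁ (refl , refl)) = refl
    closePair-injective _ _ (inj₂ (() , _))

    -- Precolored vertices are pairwise nonadjacent, so a short walk between distinct ones passes
    -- through one core vertex `core j i`. Its only precolored neighbors are those of indices `zero`
    -- and `suc i` in the family of `j`, so these are the two ends, in either order.
    closePair-surjective : ∀ xy → ∃ λ p → closePair p ≈ xy
    closePair-surjective ((pre _ _ , pre _ _) , _ , _ , x≢y , _ , ([] , _) , _) =
      contradiction refl x≢y
    closePair-surjective ((pre _ _ , pre _ _) , _ , _ , _ , _ , ((() ∷ []) , _) , _)
    closePair-surjective ((pre s _ , pre _ _) , _ , _ , x≢y , _ ,
        ((_∷_ {y = core j i} (refl , c) ((refl , c′) ∷ [])) , _) , _) with c | c′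
    ... | inj₁ refl | inj₁ refl = contradiction refl x≢y
    ... | inj₁ refl | inj₂ refl = (s , i) , inj₁ (refl , refl)
    ... | inj₂ refl | inj₁ refl = (s , i) , inj₂ (refl , refl)
    ... | inj₂ refl | inj₂ refl = contradiction refl x≢y
    closePair-surjective ((pre _ _ , pre _ _) , _ , _ , _ , _ , ((_ ∷ (_ ∷ (_ ∷ _))) , _) , s≤s (s≤s ()))

    𝒟-cardinality : HasCardinality (𝒟 (graph N) precolored 2) (2 * n′)
    𝒟-cardinality = record
      { to        = closePair ∘ remQuot {2} n′
      ; cong      = λ { refl → inj₁ (refl , refl) }
      ; bijective =
          (λ {x} {y} eq → Injection.injective (↔⇒↣ (*↔× {2} {n′})) (closePair-injective _ _ eq)) ,
          λ xy → let (s , i) , eq = closePair-surjective xy in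
            combine s i , λ { refl → subst (λ p → closePair p ≈ xy) (sym (remQuot-combine s i)) eq }
      }

    -- Weighted count of the colors of an extension.

    module _ {m : ℕ} {f : Vertex N → ℕ} (proper : IsProper _~_ f) (uses : UsesAtMost m f)
             (extends : Extends (graph N) precolored f precoloring) where

      Small : ℕ → Set
      Small x = ∃ λ (c : Fin n) → x ≡ suc (toℕ c)

      small? : ∀ x → Dec (Small x)
      small? x = any? λ c → x ℕ.≟ suc (toℕ c)

      core≢1 : ∀ j i → f (core j i) ≢ 1
      core≢1 j i eq = proper (core j i) (pre (family j) zero) (refl , inj₁ refl)
        (trans eq (sym (extends (pre (family j) zero) tt)))

      core≢index : ∀ j i → f (core j i) ≢ suc (suc (toℕ i))
      core≢index j i eq = proper (core j i) (pre (family j) (suc i)) (refl , inj₂ refl)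
        (trans eq (sym (extends (pre (family j) (suc i)) tt)))

      -- A color in [n] carries one part token, of type zero; any other color
      -- carries two, of types zero and suc zero.
      record PartTokens (j : Fin r) : Set where
        field
          token     : Fin 2 → Fin n′ × Fin 2
          injective : ∀ b b′ → f (core j (proj₁ (token b))) ≡ f (core j (proj₁ (token b′))) →
                      proj₂ (token b) ≡ proj₂ (token b′) → b ≡ b′
          large     : ∀ b → proj₂ (token b) ≡ suc zero → ¬ Small (f (core j (proj₁ (token b))))

      oneLarge : ∀ j i → ¬ Small (f (core j i)) → PartTokens j
      oneLarge j i ¬small = record
        { token     = λ b → i , b
        ; injective = λ _ _ _ b≡b′ → b≡b′
        ; large     = λ _ _ → ¬small
        }

      twoColors : ∀ j i i′ → f (core j i) ≢ f (core j i′) → PartTokens j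
      twoColors j i i′ ne = record
        { token     = λ { zero → i , zero ; (suc _) → i′ , zero }
        ; injective = λ where
            zero       zero       _  _ → refl
            zero       (suc zero) eq _ → contradiction eq ne
            (suc zero) zero       eq _ → contradiction (sym eq) ne
            (suc zero) (suc zero) _  _ → refl
        ; large     = λ { zero () ; (suc _) () }
        }

      -- If the first vertex of the part has a color in [n], that color is not 1, and the core
      -- vertex whose own index it is must avoid it; this vertex supplies a second color.
      partTokens : ∀ j → PartTokens j
      partTokens j with small? (f (core j zero))
      ... | no ¬small        = oneLarge j zero ¬small
      ... | yes (zero , eq)  = contradiction eq (core≢1 j zero)
      ... | yes (suc i , eq) = twoColors j zero i λ eq′ → core≢index j i (trans (sym eq′) eq)

      -- Besides the part tokens there are `n + 1` tokens on precolored vertices. Each color in [n]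
      -- gets one of type `suc zero`, a slot that part tokens leave free there; color 1, absent from
      -- the core, also gets one of type `zero`. This last token makes the final inequality strict.
      Token : Set
      Token = (Fin r × Fin 2) ⊎ Fin (suc n)

      vertexOf : Token → Vertex N × Fin 2
      vertexOf (inj₁ (j , b)) = let i , t = PartTokens.token (partTokens j) b in core j i , t
      vertexOf (inj₂ zero)    = pre zero zero , zero
      vertexOf (inj₂ (suc c)) = pre zero c , suc zero

      vertexOf-injective : ∀ x y → f (proj₁ (vertexOf x)) ≡ f (proj₁ (vertexOf y)) →
                           proj₂ (vertexOf x) ≡ proj₂ (vertexOf y) → x ≡ y
      -- Different parts are completely joined, hence share no color.
      vertexOf-injective (inj₁ (j , b)) (inj₁ (j′ , b′)) eq t≡ with j ≟ j′
      ... | yes refl = cong (λ b → inj₁ (j , b)) (PartTokens.injective (partTokens j) b b′ eq t≡)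
      ... | no j≢j′  = contradiction eq (proper (core j _) (core j′ _) j≢j′)
      vertexOf-injective (inj₁ (j , b)) (inj₂ zero) eq _ =
        contradiction (trans eq (extends (pre zero zero) tt)) (core≢1 j _)
      vertexOf-injective (inj₁ (j , b)) (inj₂ (suc c)) eq t≡ =
        contradiction (c , trans eq (extends (pre zero c) tt)) (PartTokens.large (partTokens j) b t≡)
      vertexOf-injective (inj₂ zero) (inj₁ (j , b)) eq _ =
        contradiction (trans (sym eq) (extends (pre zero zero) tt)) (core≢1 j _)
      vertexOf-injective (inj₂ (suc c)) (inj₁ (j , b)) eq t≡ =
        contradiction (c , trans (sym eq) (extends (pre zero c) tt))
                      (PartTokens.large (partTokens j) b (sym t≡))
      vertexOf-injective (inj₂ zero)    (inj₂ zero)     _ _  = refl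
      vertexOf-injective (inj₂ zero)    (inj₂ (suc _))  _ ()
      vertexOf-injective (inj₂ (suc _)) (inj₂ zero)     _ ()
      vertexOf-injective (inj₂ (suc c)) (inj₂ (suc c′)) eq _ =
        cong (inj₂ ∘ suc) (toℕ-injective (suc-injective
          (trans (sym (extends (pre zero c) tt)) (trans eq (extends (pre zero c′) tt)))))

      color-count : r * 2 + suc n ≤ m * 2
      color-count = injective-on-weighted-colors⇒≤ uses
        ((*↔× ⊎-↔ ↔-id _) ↔-∘ +↔⊎) vertexOf vertexOf-injective

    not-extendable : ∀ {m} → m * 2 ≤ 3 * r + k → ¬ ExtendableTo (graph N) precolored precoloring m
    not-extendable {m} 2m≤ (f , (proper , uses) , extends) = <-irrefl refl (begin-strict
      3 * r + k       <⟨ ≤-refl ⟩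
      suc (3 * r + k) ≡⟨ weights r k ⟩
      r * 2 + suc n   ≤⟨ color-count proper uses extends ⟩
      m * 2           ≤⟨ 2m≤ ⟩
      3 * r + k       ∎)
      where
      open ≤-Reasoning
      weights : ∀ r k → suc (3 * r + k) ≡ r * 2 + suc (r + k)
      weights = solve-∀

  -- An isomorphism preserves the order `r * n′ + (2 * n + N)`, which determines `N`.
  triple-distinct : ∀ N N′ → N ≢ N′ → ¬ (triple N ≅ triple N′)
  triple-distinct N N′ N≢N′ iso =
    N≢N′ (+-cancelˡ-≡ (2 * n) N N′ (+-cancelˡ-≡ (r * n′) _ _
      (↔⇒≡ (Graph.finite (graph N′) ↔-∘ (_≅_.bij iso ↔-∘ ↔-sym (Graph.finite (graph N)))))))

theorem6 : (r k : ℕ) → 2 ≤ r → 1 ≤ k → (r + k) % 2 ≡ 0 → k ≤ r →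
    InfinitelyMany λ t → let open Triple t in
    ChromaticNumberAtMost G r
    × HasCardinality (𝒟 G P 2) (2 * (r + k ∸ 1))
    × ((∀ v → d v ∈[ r + k ]) × IsPrecoloring G P d)
    × ¬ ExtendableTo G P d ((3 * r + k) / 2)
theorem6 (suc zero) _ (s≤s ())
theorem6 (suc (suc r′)) k _ _ _ _ =
  triple ,
  (λ N → (r , chromaticNumber , ≤-refl) ,
         𝒟-cardinality ,
         (precoloring-range , precoloring-proper) ,
         -- Twice the quotient by 2 is at most `3 * r + k`, while an extension would need more than
         -- that.
         not-extendable (m/n*n≤m (3 * r + k) 2)) ,
  triple-distinct
  where open Construction r′ k
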